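{- Let $\alpha>0$ be a constant and let $G=(V,E)$ be any connected finite simple graph on $n$ vertices with minimum degree $d_{\mathsf{min}}\geq\alpha\cdot n$. Then any strategy $\mathbf Q$ for the $\varepsilon$-biased random walk with $\varepsilon\leq\beta/n$ satisfies \[ \pi_{\mathbf Q}(u)\ \leq\ (1+\beta)\,\alpha^{ -2}\,\pi(u)\qquad\text{for every } u\in V. \]
   Context: Let $\mathbf P$ be the transition matrix of the simple random walk on $G$ (move to a uniformly random neighbour), with stationary distribution $\pi(v)=d(v)/\sum_w d(w)$. A strategy for the $\varepsilon$-biased random walk ($\varepsilon$-BRW) is a Markov chain with transition matrix $\mathbf Q=(1-\varepsilon)\mathbf P+\varepsilon\mathbf B$, where $\mathbf B$ is an arbitrary stochastic matrix, chosen by a controller, supported on the edges of $G$; $\pi_{\mathbf Q}$ denotes its stationary distribution. Here $\varepsilon\in[0,1)$. -}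

module Defs where

open import Level using (Level; 0ℓ; _⊔_) renaming (suc to lsuc)
open import Data.Nat.Base as ℕ using (ℕ; zero; suc)
open import Data.Fin.Base using (Fin)
open import Data.List.Base as List using (length; filter; allFin)
open import Data.Vec.Base as Vec using (tabulate)
open import Data.Product.Base using (_×_; _,_; ∃-syntax; proj₁)
open import Data.Sum.Base using (_⊎_; inj₂)
open import Relation.Nullary.Decidable.Core using (yes; no)
open import Relation.Nullary.Negation.Core using (¬_)
open import Relation.Binary.Core using (Rel)
open import Relation.Binary.Definitions using (Symmetric; Decidable)
open import Relation.Binary.Structures using (IsStrictPartialOrder)
open import Relation.Binary.PropositionalEquality.Core using (_≡_)
open import Relation.Binary.Construct.Closure.ReflexiveTransitive using (Star)
open import Algebra.Bundles using (CommutativeRing; Semiring)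
open import Algebra.Apartness.Bundles using (HeytingField)
import Algebra.Definitions.RawMonoid as RawMonoidDefs
import Algebra.Definitions.RawSemiring as RawSemiringDefs

-- The real numbers, given axiomatically as a Cauchy-complete Archimedean
-- ordered field.  The order is axiomatised constructively: _<_ is primitive
-- and _≤_ is the negation of its converse.  Cotransitivity of _<_ and
-- antisymmetry of _≤_ follow from those of _#_ and its tightness.

record RealField c ℓ₁ ℓ₂ : Set (lsuc (c ⊔ ℓ₁ ⊔ ℓ₂)) where
  field
    heytingField : HeytingField c ℓ₁ ℓ₂

  open HeytingField heytingField public

  commutativeRing : CommutativeRing c ℓ₁
  commutativeRing = record { isCommutativeRing = isCommutativeRing }

  open CommutativeRing commutativeRing public
    using (+-rawMonoid; semiring)
  open RawMonoidDefs +-rawMonoid public using (sum) renaming (_×_ to _·_)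
  open RawSemiringDefs (Semiring.rawSemiring semiring) public using (_^_)

  fromℕ : ℕ → Carrier
  fromℕ n = n · 1#

  infix 4 _<_ _≤_
  field
    _<_                  : Rel Carrier ℓ₂
    isStrictPartialOrder : IsStrictPartialOrder _≈_ _<_
    #⇒<⊎>                : ∀ {x y} → x # y → x < y ⊎ y < x
    <⇒#                  : ∀ {x y} → x < y → x # y
    +-monoˡ-<            : ∀ z {x y} → x < y → x + z < y + z
    *-positive           : ∀ {x y} → 0# < x → 0# < y → 0# < x * y
    0<1                  : 0# < 1#

  _≤_ : Rel Carrier ℓ₂
  x ≤ y = ¬ (y < x)

  -- No absolute value is needed for Cauchy: m and k range over all pairs.
  Cauchy : (ℕ → Carrier) → Set (c ⊔ ℓ₂)
  Cauchy s = ∀ δ → 0# < δ →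
    ∃[ N ] (∀ m k → N ℕ.≤ m → N ℕ.≤ k → s m - s k < δ)

  _ConvergesTo_ : (ℕ → Carrier) → Carrier → Set (c ⊔ ℓ₂)
  s ConvergesTo x = ∀ δ → 0# < δ →
    ∃[ N ] (∀ m → N ℕ.≤ m → s m - x < δ × x - s m < δ)

  field
    archimedean : ∀ x → ∃[ n ] x < fromℕ n
    complete    : ∀ s → Cauchy s → ∃[ x ] s ConvergesTo x

  open IsStrictPartialOrder isStrictPartialOrder public
    using (<-resp-≈; <-respˡ-≈; <-respʳ-≈)
    renaming (irrefl to <-irrefl; trans to <-trans)

  -- #⇒invertible inverts x - 0#.
  inverse : ∀ x → 0# < x → Carrier
  inverse x 0<x = proj₁ (#⇒invertible (#-sym (<⇒# 0<x)))

  fromℕ-positive : ∀ n → 0# < fromℕ (suc n)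
  fromℕ-positive zero    = <-respʳ-≈ (sym (+-identityʳ 1#)) 0<1
  fromℕ-positive (suc n) = <-trans (fromℕ-positive n)
    (<-respˡ-≈ (+-identityˡ (fromℕ (suc n))) (+-monoˡ-< (fromℕ (suc n)) 0<1))

  infixl 7 _/ℕ_

  -- x /ℕ 0 = 0# is only a totality convention: with a vertex present and
  -- positive minimum degree every divisor used below is positive.
  _/ℕ_ : Carrier → ℕ → Carrier
  x /ℕ zero  = 0#
  x /ℕ suc n = x * inverse (fromℕ (suc n)) (fromℕ-positive n)

record SimpleGraph (n : ℕ) : Set₁ where
  field
    Adj    : Rel (Fin n) 0ℓ
    adj?   : Decidable Adj
    symm   : Symmetric Adj
    noLoop : ∀ v → ¬ Adj v v

  degree : Fin n → ℕ
  degree v = length (filter (adj? v) (allFin n))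

  totalDegree : ℕ
  totalDegree = List.sum (List.map degree (allFin n))

  Connected : Set
  Connected = ∀ u v → Star Adj u v

-- The value for the graph without vertices is a convention.
minDegree : ∀ {n} → SimpleGraph n → ℕ
minDegree {zero}  G = 0
minDegree {suc n} G = Vec.foldr₁ ℕ._⊓_ (tabulate (SimpleGraph.degree G))

module Walk {c ℓ₁ ℓ₂} (R : RealField c ℓ₁ ℓ₂) where
  open RealField R

  Matrix : ℕ → Set c
  Matrix n = Fin n → Fin n → Carrier

  record IsDistribution {n} (μ : Fin n → Carrier) : Set (ℓ₁ ⊔ ℓ₂) where
    field
      nonNegative : ∀ v → 0# ≤ μ v
      sum≈1       : sum μ ≈ 1#

  Stochastic : ∀ {n} → Matrix n → Set (ℓ₁ ⊔ ℓ₂)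
  Stochastic M = ∀ v → IsDistribution (M v)

  record IsStationary {n} (M : Matrix n) (μ : Fin n → Carrier) : Set (ℓ₁ ⊔ ℓ₂) where
    field
      isDistribution : IsDistribution μ
      invariant      : ∀ u → sum (λ v → μ v * M v u) ≈ μ u

  module _ {n} (G : SimpleGraph n) where
    open SimpleGraph G

    simpleRandomWalk : Matrix n
    simpleRandomWalk v u with adj? v u
    ... | yes _ = 1# /ℕ degree v
    ... | no  _ = 0#

    π : Fin n → Carrier
    π v = fromℕ (degree v) /ℕ totalDegree

    SupportedOnEdges : Matrix n → Set ℓ₁
    SupportedOnEdges M = ∀ v u → ¬ Adj v u → M v u ≈ 0#

    record IsBRWStrategy (ε : Carrier) (Q : Matrix n) : Set (c ⊔ ℓ₁ ⊔ ℓ₂) where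
      field
        B                : Matrix n
        stochastic       : Stochastic B
        supportedOnEdges : SupportedOnEdges B
        decomposition    : ∀ v u → Q v u ≈ (1# - ε) * simpleRandomWalk v u + ε * B v u

{-# OPTIONS --safe #-}

-- A stationary probability is at most the largest entry of its column of the
-- transition matrix.  Every entry of Q is at most 1/(αn) + β/n ≤ (1 + β)/(αn),
-- whereas π(u) ≥ αn/n² because the degree of u is at least αn and the degrees
-- sum to at most n².  All inequalities are compared after multiplying by αn.

module Submission where

open import Defs
open import Data.Nat.Base as ℕ using (ℕ; zero; suc; z≤n; s≤s; NonZero)
import Data.Nat.ListAction as ℕ
import Data.Nat.Properties as ℕ
open import Data.Fin.Base using (Fin; zero; suc)
open import Data.Fin.Properties using (nonZeroIndex)
open import Data.Empty using (⊥)
open import Data.List.Base as List using ([]; _∷_; allFin; length)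
import Data.List.Properties as List
open import Data.List.Membership.Propositional using (_∈_)
open import Data.List.Membership.Propositional.Properties using (∈-allFin)
open import Data.List.Relation.Unary.Any using (here; there)
open import Data.Product.Base using (_,_; proj₁; proj₂)
open import Data.Sum.Base using (inj₁; inj₂)
open import Data.Vec.Base as Vec using (tabulate)
open import Relation.Nullary.Decidable.Core using (yes; no)
open import Relation.Nullary.Negation.Core using (¬_; contradiction)
open import Relation.Binary.PropositionalEquality.Core as ≡ using (_≡_)
open import Relation.Binary.Structures using (IsPreorder)
open import Algebra.Bundles using (CommutativeRing)
import Algebra.Properties.Ring as RingProperties
import Algebra.Properties.Semiring.Mult as SemiringMult
import Algebra.Properties.Semiring.Sum as SemiringSum
import Algebra.Solver.Ring.NaturalCoefficients.Default as Solver
import Relation.Binary.Reasoning.Base.Triple as TripleReasoning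

-- Natural-number bounds on degrees.

foldr₁-⊓-lower-bound : ∀ {n} (f : Fin (suc n) → ℕ) i →
                       Vec.foldr₁ ℕ._⊓_ (tabulate f) ℕ.≤ f i
foldr₁-⊓-lower-bound {zero}  f zero    = ℕ.≤-refl
foldr₁-⊓-lower-bound {suc n} f zero    = ℕ.m⊓n≤m (f zero) _
foldr₁-⊓-lower-bound {suc n} f (suc i) = ℕ.≤-trans
  (ℕ.m⊓n≤n (f zero) _) (foldr₁-⊓-lower-bound (λ j → f (suc j)) i)

module _ {a} {A : Set a} (f : A → ℕ) where

  sum-map-≤ : ∀ {b} → (∀ x → f x ℕ.≤ b) → ∀ xs →
              ℕ.sum (List.map f xs) ℕ.≤ length xs ℕ.* b
  sum-map-≤ f≤b []       = z≤n
  sum-map-≤ f≤b (x ∷ xs) = ℕ.+-mono-≤ (f≤b x) (sum-map-≤ f≤b xs)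

  ∈⇒≤sum-map : ∀ {x xs} → x ∈ xs → f x ℕ.≤ ℕ.sum (List.map f xs)
  ∈⇒≤sum-map (here ≡.refl) = ℕ.m≤m+n _ _
  ∈⇒≤sum-map (there x∈xs)  = ℕ.≤-trans (∈⇒≤sum-map x∈xs) (ℕ.m≤n+m _ _)

minDegree≤degree : ∀ {n} (G : SimpleGraph n) v →
                   minDegree G ℕ.≤ SimpleGraph.degree G v
minDegree≤degree {suc n} G = foldr₁-⊓-lower-bound (SimpleGraph.degree G)

module _ {n} (G : SimpleGraph n) where
  open SimpleGraph G

  length-allFin : length (allFin n) ≡ n
  length-allFin = List.length-tabulate (λ i → i)

  degree≤n : ∀ v → degree v ℕ.≤ n
  degree≤n v = ≡.subst (degree v ℕ.≤_) length-allFin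
    (List.length-filter (adj? v) (allFin n))

  degree≤totalDegree : ∀ v → degree v ℕ.≤ totalDegree
  degree≤totalDegree v = ∈⇒≤sum-map degree (∈-allFin v)

  totalDegree≤n² : totalDegree ℕ.≤ n ℕ.* n
  totalDegree≤n² = ≡.subst (λ k → totalDegree ℕ.≤ k ℕ.* n) length-allFin
    (sum-map-≤ degree degree≤n (allFin n))

-- Ordered-field arithmetic with a negatively defined `_≤_`.

module RealFieldProperties {c ℓ₁ ℓ₂} (R : RealField c ℓ₁ ℓ₂) where
  open RealField R hiding (zero)
  open CommutativeRing commutativeRing using (ring; commutativeSemiring)
  open RingProperties ring using (-0#≈0#)
  open SemiringMult semiring using (×1-homo-*)
  open SemiringSum semiring using (*-distribʳ-sum)

  <⇒≤ : ∀ {x y} → x < y → x ≤ y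
  <⇒≤ x<y y<x = <-irrefl refl (<-trans x<y y<x)

  -- A strict inequality must be produced although `_≤_` is only a negation. Cotransitivity of
  -- apartness puts `z` apart from `x` or from `y`, and the hypotheses rule out the wrong orders.
  <-≤-trans : ∀ {x y z} → x < y → y ≤ z → x < z
  <-≤-trans {x} {y} {z} x<y y≤z with #-cotrans (<⇒# x<y) z
  ... | inj₁ x#z with #⇒<⊎> x#z
  ...   | inj₁ x<z = x<z
  ...   | inj₂ z<x = contradiction (<-trans z<x x<y) y≤z
  <-≤-trans {x} {y} {z} x<y y≤z | inj₂ z#y with #⇒<⊎> z#y
  ...   | inj₁ z<y = contradiction z<y y≤z
  ...   | inj₂ y<z = <-trans x<y y<z

  ≤-<-trans : ∀ {x y z} → x ≤ y → y < z → x < z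
  ≤-<-trans {x} {y} {z} x≤y y<z with #-cotrans (<⇒# y<z) x
  ... | inj₂ x#z with #⇒<⊎> x#z
  ...   | inj₁ x<z = x<z
  ...   | inj₂ z<x = contradiction (<-trans y<z z<x) x≤y
  ≤-<-trans {x} {y} {z} x≤y y<z | inj₁ y#x with #⇒<⊎> y#x
  ...   | inj₁ y<x = contradiction y<x x≤y
  ...   | inj₂ x<y = <-trans x<y y<z

  ≤-isPreorder : IsPreorder _≈_ _≤_
  ≤-isPreorder = record
    { isEquivalence = isEquivalence
    ; reflexive     = λ x≈y → <-irrefl (sym x≈y)
    ; trans         = λ x≤y y≤z z<x → y≤z (<-≤-trans z<x x≤y)
    }

  open IsPreorder ≤-isPreorder public
    using () renaming (refl to ≤-refl; reflexive to ≤-reflexive; trans to ≤-trans)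

  module ≤-Reasoning = TripleReasoning ≤-isPreorder <⇒≤ <-trans <-resp-≈
    <⇒≤ <-≤-trans ≤-<-trans

  -- Classical case analysis is available when proving a negation, because
  -- the apartness is tight.
  ≤-elim : ∀ {x y} → x ≤ y → ¬ (x < y) → ¬ (x ≈ y) → ⊥
  ≤-elim {x} {y} x≤y x≮y x≉y = x≉y (proj₁ (tight x y) λ x#y → apart (#⇒<⊎> x#y))
    where
    apart : _ → ⊥
    apart (inj₁ x<y) = x≮y x<y
    apart (inj₂ y<x) = x≤y y<x

  +-monoˡ-≤ : ∀ z {x y} → x ≤ y → x + z ≤ y + z
  +-monoˡ-≤ z {x} {y} x≤y y+z<x+z =
    x≤y (<-respˡ-≈ (cancel y) (<-respʳ-≈ (cancel x) (+-monoˡ-< (- z) y+z<x+z)))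
    where
    cancel : ∀ w → w + z + - z ≈ w
    cancel w = trans (+-assoc w z (- z))
      (trans (+-congˡ (-‿inverseʳ z)) (+-identityʳ w))

  +-mono-≤ : ∀ {w x y z} → w ≤ x → y ≤ z → w + y ≤ x + z
  +-mono-≤ {w} {x} {y} {z} w≤x y≤z = begin
    w + y ≤⟨ +-monoˡ-≤ y w≤x ⟩
    x + y ≈⟨ +-comm x y ⟩
    y + x ≤⟨ +-monoˡ-≤ x y≤z ⟩
    z + x ≈⟨ +-comm z x ⟩
    x + z ∎
    where open ≤-Reasoning

  -- The difference `(y - x) * z` is a product of positives; adding `x * z` to it gives `y * z`.
  *-monoˡ-< : ∀ {z} → 0# < z → ∀ {x y} → x < y → x * z < y * z
  *-monoˡ-< {z} 0<z {x} {y} x<y = begin-strict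
    x * z                     ≈⟨ +-identityˡ (x * z) ⟨
    0# + x * z                <⟨ +-monoˡ-< (x * z) (*-positive 0<y-x 0<z) ⟩
    (y + - x) * z + x * z     ≈⟨ distribʳ z (y + - x) x ⟨
    (y + - x + x) * z         ≈⟨ *-congʳ (+-assoc y (- x) x) ⟩
    (y + (- x + x)) * z       ≈⟨ *-congʳ (+-congˡ (-‿inverseˡ x)) ⟩
    (y + 0#) * z              ≈⟨ *-congʳ (+-identityʳ y) ⟩
    y * z                     ∎
    where
    open ≤-Reasoning
    0<y-x : 0# < y + - x
    0<y-x = <-respˡ-≈ (-‿inverseʳ x) (+-monoˡ-< (- x) x<y)

  -- The contrapositive of `*-monoˡ-<`. It lets quotients be compared after clearing denominators.
  *-cancelʳ-≤ : ∀ {z} → 0# < z → ∀ {x y} → x * z ≤ y * z → x ≤ y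
  *-cancelʳ-≤ 0<z xz≤yz y<x = xz≤yz (*-monoˡ-< 0<z y<x)

  -- The conclusion is a negation, so `≤-elim` allows splitting `z` into positive or zero, and then
  -- `x` into below or equal to `y`.
  *-monoˡ-≤ : ∀ {z} → 0# ≤ z → ∀ {x y} → x ≤ y → x * z ≤ y * z
  *-monoˡ-≤ {z} 0≤z {x} {y} x≤y yz<xz = ≤-elim 0≤z
    (λ 0<z → ≤-elim x≤y
      (λ x<y → <⇒≤ yz<xz (*-monoˡ-< 0<z x<y))
      (λ x≈y → <-irrefl (*-congʳ (sym x≈y)) yz<xz))
    (λ 0≈z → <-irrefl (trans (0≈w*z 0≈z y) (sym (0≈w*z 0≈z x))) yz<xz)
    where
    0≈w*z : 0# ≈ z → ∀ w → w * z ≈ 0#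
    0≈w*z 0≈z w = trans (*-congˡ (sym 0≈z)) (zeroʳ w)

  *-monoʳ-≤ : ∀ {z} → 0# ≤ z → ∀ {x y} → x ≤ y → z * x ≤ z * y
  *-monoʳ-≤ {z} 0≤z {x} {y} x≤y = begin
    z * x ≈⟨ *-comm z x ⟩
    x * z ≤⟨ *-monoˡ-≤ 0≤z x≤y ⟩
    y * z ≈⟨ *-comm y z ⟩
    z * y ∎
    where open ≤-Reasoning

  *-nonNegative : ∀ {x y} → 0# ≤ x → 0# ≤ y → 0# ≤ x * y
  *-nonNegative {x} {y} 0≤x 0≤y = ≤-trans
    (≤-reflexive (sym (zeroˡ y))) (*-monoˡ-≤ 0≤y 0≤x)

  +-nonNegative : ∀ {x y} → 0# ≤ x → 0# ≤ y → 0# ≤ x + y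
  +-nonNegative 0≤x 0≤y = ≤-trans
    (≤-reflexive (sym (+-identityˡ 0#))) (+-mono-≤ 0≤x 0≤y)

  x≤x+y : ∀ x {y} → 0# ≤ y → x ≤ x + y
  x≤x+y x 0≤y = ≤-trans
    (≤-reflexive (sym (+-identityʳ x))) (+-mono-≤ ≤-refl 0≤y)

  x≤y+x : ∀ x {y} → 0# ≤ y → x ≤ y + x
  x≤y+x x {y} 0≤y = ≤-trans (x≤x+y x 0≤y) (≤-reflexive (+-comm x y))

  0≤1 : 0# ≤ 1#
  0≤1 = <⇒≤ 0<1

  -- Natural numbers in the field and division by them.

  fromℕ-mono-≤ : ∀ {m n} → m ℕ.≤ n → fromℕ m ≤ fromℕ n
  fromℕ-mono-≤ {n = zero}  z≤n       = ≤-refl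
  fromℕ-mono-≤ {n = suc n} z≤n       = <⇒≤ (fromℕ-positive n)
  fromℕ-mono-≤             (s≤s m≤n) = +-mono-≤ ≤-refl (fromℕ-mono-≤ m≤n)

  0<fromℕ : ∀ n .{{_ : NonZero n}} → 0# < fromℕ n
  0<fromℕ (suc n) = fromℕ-positive n

  fromℕ-nonZero : ∀ n → 0# < fromℕ n → NonZero n
  fromℕ-nonZero zero    0<0 = contradiction 0<0 ≤-refl
  fromℕ-nonZero (suc n) _   = _

  inverseˡ : ∀ {x} (0<x : 0# < x) → inverse x 0<x * x ≈ 1#
  -- The inverse supplied is that of `x - 0#`, so `x` is first rewritten in that form.
  inverseˡ {x} 0<x = trans (*-congˡ (sym x-0≈x))
    (proj₁ (proj₂ (#⇒invertible (#-sym (<⇒# 0<x)))))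
    where
    x-0≈x : x - 0# ≈ x
    x-0≈x = trans (+-congˡ -0#≈0#) (+-identityʳ x)

  /ℕ-*-cancel : ∀ x n .{{_ : NonZero n}} → x /ℕ n * fromℕ n ≈ x
  /ℕ-*-cancel x (suc n) = trans (*-assoc x _ _)
    (trans (*-congˡ (inverseˡ (fromℕ-positive n))) (*-identityʳ x))

  /ℕ-nonNegative : ∀ {x} → 0# ≤ x → ∀ n → 0# ≤ x /ℕ n
  /ℕ-nonNegative 0≤x zero    = ≤-refl
  /ℕ-nonNegative {x} 0≤x (suc n) = *-cancelʳ-≤ (fromℕ-positive n) (begin
    0# * fromℕ (suc n)           ≈⟨ zeroˡ _ ⟩
    0#                           ≤⟨ 0≤x ⟩
    x                            ≈⟨ /ℕ-*-cancel x (suc n) ⟨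
    x /ℕ suc n * fromℕ (suc n)   ∎)
    where open ≤-Reasoning

  -- Finite sums, distributions and stationarity.

  sum-mono-≤ : ∀ {n} {f g : Fin n → Carrier} → (∀ i → f i ≤ g i) → sum f ≤ sum g
  sum-mono-≤ {zero}  f≤g = ≤-refl
  sum-mono-≤ {suc n} f≤g = +-mono-≤ (f≤g zero) (sum-mono-≤ (λ i → f≤g (suc i)))

  sum-nonNegative : ∀ {n} {f : Fin n → Carrier} → (∀ i → 0# ≤ f i) → 0# ≤ sum f
  sum-nonNegative {zero}  0≤f = ≤-refl
  sum-nonNegative {suc n} 0≤f =
    +-nonNegative (0≤f zero) (sum-nonNegative (λ i → 0≤f (suc i)))

  term≤sum : ∀ {n} {f : Fin n → Carrier} → (∀ i → 0# ≤ f i) → ∀ i → f i ≤ sum f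
  term≤sum 0≤f zero = x≤x+y _ (sum-nonNegative (λ i → 0≤f (suc i)))
  term≤sum 0≤f (suc i) = ≤-trans
    (term≤sum (λ j → 0≤f (suc j)) i) (x≤y+x _ (0≤f zero))

  open Walk R

  distribution≤1 : ∀ {n} {μ : Fin n → Carrier} → IsDistribution μ → ∀ i → μ i ≤ 1#
  distribution≤1 μ-dist i = ≤-trans (term≤sum nonNegative i) (≤-reflexive sum≈1)
    where open IsDistribution μ-dist

  -- By invariance `μ u` is the `μ`-weighted average of column `u` of `M`. The factor `k` permits an
  -- entrywise bound with its denominator cleared.
  stationary-≤ : ∀ {n} {M : Matrix n} {μ : Fin n → Carrier} → IsStationary M μ →
                 ∀ {k b} u → (∀ v → M v u * k ≤ b) → μ u * k ≤ b
  stationary-≤ {M = M} {μ} μ-stat {k} {b} u Mk≤b = begin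
    μ u * k                      ≈⟨ *-congʳ (invariant u) ⟨
    sum (λ v → μ v * M v u) * k  ≈⟨ *-distribʳ-sum k (λ v → μ v * M v u) ⟩
    sum (λ v → μ v * M v u * k)  ≤⟨ sum-mono-≤ term ⟩
    sum (λ v → μ v * b)          ≈⟨ *-distribʳ-sum b μ ⟨
    sum μ * b                    ≈⟨ *-congʳ sum≈1 ⟩
    1# * b                       ≈⟨ *-identityˡ b ⟩
    b                            ∎
    where
    open IsStationary μ-stat
    open IsDistribution isDistribution
    open ≤-Reasoning
    term : ∀ v → μ v * M v u * k ≤ μ v * b
    term v = ≤-trans (≤-reflexive (*-assoc (μ v) (M v u) k))
      (*-monoʳ-≤ (nonNegative v) (Mk≤b v))

  -- The two sides differ by `ε * x`, which is nonnegative.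
  [1-ε]x≤x : ∀ {ε x} → 0# ≤ ε → 0# ≤ x → (1# - ε) * x ≤ x
  [1-ε]x≤x {ε} {x} 0≤ε 0≤x = begin
    (1# - ε) * x          ≤⟨ x≤x+y _ (*-nonNegative 0≤ε 0≤x) ⟩
    (1# - ε) * x + ε * x  ≈⟨ distribʳ x (1# - ε) ε ⟨
    (1# - ε + ε) * x      ≈⟨ *-congʳ (+-assoc 1# (- ε) ε) ⟩
    (1# + (- ε + ε)) * x  ≈⟨ *-congʳ (+-congˡ (-‿inverseˡ ε)) ⟩
    (1# + 0#) * x         ≈⟨ *-congʳ (+-identityʳ 1#) ⟩
    1# * x                ≈⟨ *-identityˡ x ⟩
    x                     ∎
    where open ≤-Reasoning

  -- The simple random walk on a graph.

  module _ {n} (G : SimpleGraph n) where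
    open SimpleGraph G

    simpleRandomWalk-nonNegative : ∀ v u → 0# ≤ simpleRandomWalk G v u
    simpleRandomWalk-nonNegative v u with adj? v u
    ... | yes _ = /ℕ-nonNegative 0≤1 (degree v)
    ... | no  _ = ≤-refl

    simpleRandomWalk*degree≤1 : ∀ v u → simpleRandomWalk G v u * fromℕ (degree v) ≤ 1#
    simpleRandomWalk*degree≤1 v u with adj? v u
    ... | no  _ = ≤-trans (≤-reflexive (zeroˡ _)) 0≤1
    ... | yes _ with degree v
    -- Here the entry is `1# /ℕ 0`, which is `0#` by convention.
    ...   | zero  = ≤-trans (≤-reflexive (zeroˡ _)) 0≤1
    ...   | suc d = ≤-reflexive (/ℕ-*-cancel 1# (suc d))

    -- Graphs of linear minimum degree.

    module _ (v₀ : Fin n) {α} (0<α : 0# < α)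
             (αn≤δ : α * fromℕ n ≤ fromℕ (minDegree G)) where

      private
        instance
          n-nonZero : NonZero n
          n-nonZero = nonZeroIndex v₀

        N K : Carrier
        N = fromℕ n
        K = α * N

      0<αn : 0# < K
      0<αn = *-positive 0<α (0<fromℕ n)

      αn≤degree : ∀ v → K ≤ fromℕ (degree v)
      αn≤degree v = ≤-trans αn≤δ (fromℕ-mono-≤ (minDegree≤degree G v))

      -- A degree lies between `αn` and `n`; the vertex `v₀` supplies one and makes `n` positive.
      α≤1 : α ≤ 1#
      α≤1 = *-cancelʳ-≤ (0<fromℕ n) (begin
        α * N                ≤⟨ αn≤degree v₀ ⟩
        fromℕ (degree v₀)    ≤⟨ fromℕ-mono-≤ (degree≤n G v₀) ⟩
        N                    ≈⟨ *-identityˡ N ⟨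
        1# * N               ∎)
        where open ≤-Reasoning

      -- Write `a` for the inverse of `α` and `T` for the total degree. Then `T ≤ n²`, which is
      -- `(a * K)²`, and this is at most `a² * d(u) * K` with `d(u)` equal to `π(u) * T`. Cancelling
      -- `T` leaves the claim.
      α⁻²*π*αn≥1 : ∀ u → 1# ≤ inverse α 0<α ^ 2 * π G u * K
      α⁻²*π*αn≥1 u = *-cancelʳ-≤ (0<fromℕ totalDegree) (begin
        1# * T                             ≈⟨ *-identityˡ T ⟩
        T                                  ≤⟨ fromℕ-mono-≤ (totalDegree≤n² G) ⟩
        fromℕ (n ℕ.* n)                    ≈⟨ ×1-homo-* n n ⟩
        N * N                              ≈⟨ *-cong α⁻¹*αn≈n α⁻¹*αn≈n ⟨
        -- The `con 1` reflects that `a ^ 2` unfolds to `a * (a * 1#)`.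
        a * K * (a * K)                    ≈⟨ solve 2 (λ a k →
          a :* k :* (a :* k) := a :* (a :* con 1) :* k :* k) refl a K ⟩
        -- Only one factor `K` is raised to the degree; the other remains as the common scale.
        a ^ 2 * K * K                      ≤⟨ *-monoˡ-≤ 0≤αn (*-monoʳ-≤ 0≤a² (αn≤degree u)) ⟩
        a ^ 2 * D * K                      ≈⟨ *-congʳ (*-congˡ (/ℕ-*-cancel D totalDegree)) ⟨
        a ^ 2 * (π G u * T) * K            ≈⟨ solve 4 (λ a p t k →
          a :* (p :* t) :* k := a :* p :* k :* t) refl (a ^ 2) (π G u) T K ⟩
        a ^ 2 * π G u * K * T              ∎)
        where
        open ≤-Reasoning
        open Solver commutativeSemiring
        T D a : Carrier
        T = fromℕ totalDegree
        D = fromℕ (degree u)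
        a = inverse α 0<α
        0≤αn : 0# ≤ K
        0≤αn = <⇒≤ 0<αn
        instance
          totalDegree-nonZero : NonZero totalDegree
          -- From `0 < αn ≤ d(u) ≤ T`, so the quotient defining `π` is a genuine one.
          totalDegree-nonZero = fromℕ-nonZero totalDegree (<-≤-trans 0<αn
            (≤-trans (αn≤degree u) (fromℕ-mono-≤ (degree≤totalDegree G u))))
        a*α≈1 : a * α ≈ 1#
        a*α≈1 = inverseˡ 0<α
        0≤a : 0# ≤ a
        0≤a = *-cancelʳ-≤ 0<α (begin
          0# * α ≈⟨ zeroˡ α ⟩
          0#     ≤⟨ 0≤1 ⟩
          1#     ≈⟨ a*α≈1 ⟨
          a * α  ∎)
        0≤a² : 0# ≤ a ^ 2
        0≤a² = *-nonNegative 0≤a (*-nonNegative 0≤a 0≤1)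
        α⁻¹*αn≈n : a * K ≈ N
        α⁻¹*αn≈n = trans (sym (*-assoc a α N)) (trans (*-congʳ a*α≈1) (*-identityˡ N))

      -- Strategies with bias at most `β / n`.

      module _ {β ε} (0≤ε : 0# ≤ ε) (ε≤β/n : ε ≤ β /ℕ n) where

        εn≤β : ε * N ≤ β
        εn≤β = ≤-trans (*-monoˡ-≤ (<⇒≤ (0<fromℕ n)) ε≤β/n)
          (≤-reflexive (/ℕ-*-cancel β n))

        -- The sign of `β` is forced by `0 ≤ εn ≤ β`.
        0≤β : 0# ≤ β
        0≤β = ≤-trans (*-nonNegative 0≤ε (<⇒≤ (0<fromℕ n))) εn≤β

        ε*αn≤β : ε * K ≤ β
        ε*αn≤β = begin
          ε * (α * N)  ≈⟨ solve 3 (λ e a m → e :* (a :* m) := a :* (e :* m)) refl ε α N ⟩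
          α * (ε * N)  ≤⟨ *-monoʳ-≤ (<⇒≤ 0<α) εn≤β ⟩
          α * β        ≤⟨ *-monoˡ-≤ 0≤β α≤1 ⟩
          1# * β       ≈⟨ *-identityˡ β ⟩
          β            ∎
          where
          open ≤-Reasoning
          open Solver commutativeSemiring

        -- Dropping the factor `1 - ε` and bounding the entry of `B` by 1 gives `Q v u ≤ P + ε`.
        -- After scaling by `K`, the walk contributes at most `P * d(v) ≤ 1` and the bias at most
        -- `β`.
        strategy*αn≤1+β : ∀ {Q} → IsBRWStrategy G ε Q → ∀ v u → Q v u * K ≤ 1# + β
        strategy*αn≤1+β {Q} strategy v u = begin
          Q v u * K                              ≈⟨ *-congʳ (decomposition v u) ⟩
          ((1# - ε) * P + ε * B v u) * K         ≤⟨ *-monoˡ-≤ (<⇒≤ 0<αn) (+-mono-≤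
            ([1-ε]x≤x 0≤ε 0≤P) (*-monoʳ-≤ 0≤ε (distribution≤1 (stochastic v) u))) ⟩
          (P + ε * 1#) * K                       ≈⟨ *-congʳ (+-congˡ (*-identityʳ ε)) ⟩
          (P + ε) * K                            ≈⟨ distribʳ K P ε ⟩
          P * K + ε * K                          ≤⟨ +-mono-≤
            (≤-trans (*-monoʳ-≤ 0≤P (αn≤degree v)) (simpleRandomWalk*degree≤1 v u)) ε*αn≤β ⟩
          1# + β                                 ∎
          where
          open IsBRWStrategy strategy
          open ≤-Reasoning
          P : Carrier
          P = simpleRandomWalk G v u
          0≤P : 0# ≤ P
          0≤P = simpleRandomWalk-nonNegative v u

        -- The upper bound on `μ u` and the lower bound on `π(u)` both carry the scale `K`, so they
        -- chain through `1 + β` and `K` cancels.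
        stationary≤ : ∀ {Q μ} → IsBRWStrategy G ε Q → IsStationary Q μ → ∀ u →
                      μ u ≤ (1# + β) * (inverse α 0<α ^ 2) * π G u
        stationary≤ {Q} {μ} strategy stat u = *-cancelʳ-≤ 0<αn (begin
          μ u * K                        ≤⟨ stationary-≤ stat u (λ v → strategy*αn≤1+β strategy v u) ⟩
          1# + β                         ≈⟨ *-identityʳ (1# + β) ⟨
          (1# + β) * 1#                  ≤⟨ *-monoʳ-≤ (+-nonNegative 0≤1 0≤β) (α⁻²*π*αn≥1 u) ⟩
          (1# + β) * (a² * π G u * K)    ≈⟨ solve 4 (λ b a p k →
            b :* (a :* p :* k) := b :* a :* p :* k) refl (1# + β) a² (π G u) K ⟩
          (1# + β) * a² * π G u * K      ∎)
          where
          open ≤-Reasoning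
          open Solver commutativeSemiring
          a² : Carrier
          a² = inverse α 0<α ^ 2

proposition4p7 : ∀ {c ℓ₁ ℓ₂} (R : RealField c ℓ₁ ℓ₂) →
    let open RealField R
        open Walk R in
    (α : Carrier) (0<α : 0# < α)
    (n : ℕ) (G : SimpleGraph n) →
    SimpleGraph.Connected G →
    α * fromℕ n ≤ fromℕ (minDegree G) →
    (β ε : Carrier) →
    0# ≤ ε → ε < 1# →
    ε ≤ β /ℕ n →
    (Q : Matrix n) → IsBRWStrategy G ε Q →
    (π-Q : Fin n → Carrier) → IsStationary Q π-Q →
    (u : Fin n) →
    π-Q u ≤ (1# + β) * (inverse α 0<α ^ 2) * π G u
proposition4p7 R α 0<α n G _ αn≤δ β ε 0≤ε _ ε≤β/n Q strategy π-Q stat u =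
  -- The vertex `u` also serves as the witness `v₀` that the graph is nonempty.
  RealFieldProperties.stationary≤ R G u 0<α αn≤δ 0≤ε ε≤β/n strategy stat u
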